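{- Let $m,n\ge1$ be integers. There is a bijection from $\mathrm{PPF}^{\mathrm{inc}}(S_{m*,n})$ to $\mathrm{PF}^{\mathrm{inc}}(S_{(m-1)*,n})$. In particular, $|\mathrm{PPF}^{\mathrm{inc}}(S_{m*,n})|=|\mathrm{PF}^{\mathrm{inc}}(S_{(m-1)*,n})|=\frac1m\binom{2m-2}{m-1}\binom{2m+n-2}{n}$.
   Context: For integers $a\ge0$, $n\ge1$, the complete split graph $S_{a*,n}$ has a clique on $C=\{v^c_0,\dots,v^c_a\}$, an independent set $I=\{v^i_1,\dots,v^i_n\}$, and a single edge between each pair in $C\times I$; it is simple and its sink is $v^c_0$. $\mathbb N=\{1,2,\dots\}$. For a graph $H$ (finite multigraph, no loops) with sink $s$, vertex set $V_H$, non-sink vertex set $\tilde V_H$, write $\deg^A(v)=\sum_{w\in A}\mathrm{mult}(vw)$, $\mathrm{mult}(vw)$ the number of edges between $v,w$. An $H$-parking function is $f:\tilde V_H\to\mathbb N$ such that every non-empty $S\subseteq\tilde V_H$ contains $v$ with $f(v)\le\deg^{V_H\setminus S}(v)$; $\mathrm{PF}(H)$ is their set. For a graph $G$ with sink $s$ and $A\subseteq\tilde V$, $G^A$ is the induced subgraph on $A\cup\{s\}$ with sink $s$. For $f\in\mathrm{PF}(G)$ and an ordered partition $(A,B)$ of $\tilde V$ with $A,B\neq\emptyset$, set $f^A=f|_A$, $f^B(v)=f(v)-\deg^A(v)$ ($v\in B$); $f$ is decomposable w.r.t. $(A,B)$ if $f^A\in\mathrm{PF}(G^A)$ and $f^B\in\mathrm{PF}(G^B)$;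 $f$ is prime if decomposable w.r.t. no such partition; $\mathrm{PPF}(G)$ is the set of prime $G$-parking functions. A function $f$ on the non-sink vertices of $S_{a*,n}$ is increasing if $f(v^c_1)\le\dots\le f(v^c_a)$ and $f(v^i_1)\le\dots\le f(v^i_n)$. $\mathrm{PF}^{\mathrm{inc}}$ and $\mathrm{PPF}^{\mathrm{inc}}$ denote the sets of increasing parking functions and increasing prime parking functions. -}

module Defs where

open import Data.Nat using (ℕ; zero; suc; _+_; _*_; _∸_; _≤_; _<_; _≤ᵇ_)
open import Data.Bool using (Bool; true; false; _∧_; _∨_; not; if_then_else_)
open import Data.Fin using (Fin; zero; suc; toℕ)
open import Data.Fin.Properties using () renaming (_≟_ to _≟ᶠ_)
open import Data.Product using (Σ; ∃; _×_; _,_; proj₁; proj₂)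
open import Data.Sum using (_⊎_)
open import Relation.Nullary using (¬_; does)
open import Relation.Binary.Bundles using (Setoid)
open import Relation.Binary.PropositionalEquality using (_≡_; refl; sym; trans)

∑ : (n : ℕ) → (Fin n → ℕ) → ℕ
∑ zero    f = 0
∑ (suc n) f = f zero + ∑ n (λ i → f (suc i))

-- Graphs with a sink.
-- A graph with k non-sink vertices has vertex set Fin (suc k); the sink
-- is the vertex  zero , and the non-sink vertex  u : Fin k  is the vertex
-- suc u .  mult v w  is the number of edges between v and w.

record Graph : Set where
  field
    k    : ℕ
    mult : Fin (suc k) → Fin (suc k) → ℕ

module _ (G : Graph) where
  open Graph G

  NSubset : Set
  NSubset = Fin k → Bool

  VSubset : Set
  VSubset = Fin (suc k) → Bool

  deg : VSubset → Fin (suc k) → ℕ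
  deg W v = ∑ (suc k) (λ w → if W w then mult v w else 0)

  emb : NSubset → VSubset
  emb A zero    = false
  emb A (suc u) = A u

  NonEmpty : NSubset → Set
  NonEmpty S = ∃ λ u → S u ≡ true

  _⊆_ : NSubset → NSubset → Set
  S ⊆ A = ∀ u → S u ≡ true → A u ≡ true

  compl : NSubset → NSubset
  compl A u = not (A u)

  withSinkMinus : NSubset → NSubset → VSubset
  withSinkMinus A S zero    = true
  withSinkMinus A S (suc u) = A u ∧ not (S u)

  -- f (restricted to A) is a G^A-parking function, where G^A is the
  -- induced subgraph on A ∪ {s} with sink s.  Values of f outside A are
  -- irrelevant (a function on the non-sink vertices of G^A is the
  -- restriction of f to A).  Values lie in ℕ = {1,2,...}.
  IsPFOn : NSubset → (Fin k → ℕ) → Set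
  IsPFOn A f =
    (∀ u → A u ≡ true → 1 ≤ f u) ×
    (∀ (S : NSubset) → S ⊆ A → NonEmpty S →
       ∃ λ u → S u ≡ true × f u ≤ deg (withSinkMinus A S) (suc u))

  allN : NSubset
  allN _ = true

  IsPF : (Fin k → ℕ) → Set
  IsPF f = IsPFOn allN f

  -- f^B(v) = f(v) - deg^A(v) for v in B  (truncated subtraction is harmless:
  -- if f(v) ≤ deg^A(v) then f^B(v) ∉ ℕ = {1,2,...}, and the positivity
  -- requirement in IsPFOn fails for the value 0, as it should)
  restB : NSubset → (Fin k → ℕ) → (Fin k → ℕ)
  restB A f u = f u ∸ deg (emb A) (suc u)

  Decomposable : (Fin k → ℕ) → NSubset → Set
  Decomposable f A = IsPFOn A f × IsPFOn (compl A) (restB A f)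

  IsPPF : (Fin k → ℕ) → Set
  IsPPF f = IsPF f ×
    (∀ (A : NSubset) → NonEmpty A → NonEmpty (compl A) → ¬ Decomposable f A)

-- Complete split graph S_{a*,n}.
-- Vertices: index 0..a are the clique vertices v^c_0..v^c_a (v^c_0 = sink),
-- indices a+1..a+n are the independent vertices v^i_1..v^i_n.
-- Non-sink vertex u : Fin (a + n) is v^c_{u+1} if toℕ u < a and
-- v^i_{u-a+1} otherwise.

splitMult : (a n : ℕ) → Fin (suc (a + n)) → Fin (suc (a + n)) → ℕ
splitMult a n v w =
  if does (v ≟ᶠ w) then 0
  else (if (toℕ v ≤ᵇ a) ∨ (toℕ w ≤ᵇ a) then 1 else 0)

Split : ℕ → ℕ → Graph
Split a n = record { k = a + n ; mult = splitMult a n }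

-- increasing: f(v^c_1) ≤ ... ≤ f(v^c_a) and f(v^i_1) ≤ ... ≤ f(v^i_n)
IsIncreasing : (a n : ℕ) → (Fin (a + n) → ℕ) → Set
IsIncreasing a n f =
  ∀ (u w : Fin (a + n)) → toℕ u ≤ toℕ w → (toℕ w < a ⊎ a ≤ toℕ u) → f u ≤ f w

funSetoid : (k : ℕ) → ((Fin k → ℕ) → Set) → Setoid _ _
funSetoid k P = record
  { Carrier = Σ (Fin k → ℕ) P
  ; _≈_ = λ x y → ∀ u → proj₁ x u ≡ proj₁ y u
  ; isEquivalence = record
    { refl = λ u → refl
    ; sym = λ p u → sym (p u)
    ; trans = λ p q u → trans (p u) (q u)
    }
  }

PFinc : (a n : ℕ) → Setoid _ _
PFinc a n = funSetoid (a + n) (λ f → IsPF (Split a n) f × IsIncreasing a n f)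

PPFinc : (a n : ℕ) → Setoid _ _
PPFinc a n = funSetoid (a + n) (λ f → IsPPF (Split a n) f × IsIncreasing a n f)

{-# OPTIONS --safe #-}
module Submission where

-- Write c_0 ≤ c_1 ≤ … and i_0 ≤ i_1 ≤ … for the values on the clique and on the
-- independent vertices, and N(t) for the number of q with i_q ≤ t.  Burning greedily,
-- an increasing f is a parking function of S_{a*,n} iff it is positive, all i_q ≤ a + 1
-- and c_p ≤ 1 + p + N(1 + p) for all p.  It can only be decomposable along an initial
-- segment of the burning order, which makes it prime iff c_0 = 1 and deleting the first
-- clique vertex leaves a parking function of S_{(a-1)*,n}: this is the bijection.
-- For the count, record the i_q by a word in a letters U and n letters H (i_q - 1 letters
-- U precede the q-th H) and insert the p-th of a letters D before its letter of index
-- c_p - 1; the inequalities say that the p-th D precedes the p-th U, so that the words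
-- are Dyck words with n letters H inserted.

open import Defs
open import Data.Bool using (Bool; true; false; _∧_; not; if_then_else_)
open import Data.Bool.Properties using (∨-zeroʳ; ∧-zeroʳ; T-≡; ¬-not)
open import Data.Empty using (⊥)
open import Data.Fin using (Fin; zero; suc; toℕ; _↑ˡ_; _↑ʳ_; splitAt)
open import Data.Fin.Properties using (toℕ-↑ˡ; toℕ-↑ʳ; toℕ<n; join-splitAt; suc-injective; ↑ʳ-injective; +↔⊎; 0↔⊥; 1↔⊤) renaming (_≟_ to _≟ᶠ_)
open import Data.Nat using (ℕ; zero; suc; pred; _+_; _*_; _∸_; _≤_; _<_; _<ᵇ_; _!; z≤n; s≤s; s≤s⁻¹)
open import Data.Nat.Combinatorics using (_C_; k![n∸k]!∣n!; nCk≡n!/k![n-k]!)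
open import Data.Nat.DivMod using (_/_; m*n/n≡m; m/n*n≡m)
open import Data.Nat.Properties hiding (suc-injective)
open import Data.Nat.Tactic.RingSolver using (solve-∀)
open import Data.Product using (Σ; ∃; _×_; _,_; proj₁; proj₂)
open import Data.Sum using (_⊎_; inj₁; inj₂; [_,_]′)
open import Data.Sum.Function.Propositional using (_⊎-↔_)
open import Data.Unit using (⊤; tt)
open import Data.Vec.Functional using (_++_)
open import Data.Vec.Functional.Properties using (lookup-++ˡ; lookup-++ʳ)
open import Function.Base using (_∘_)
open import Function.Bundles using (Bijection; Equivalence; _↔_; mk↔ₛ′)
import Function.Construct.Symmetry as Symmetry
open import Function.Properties.Bijection using (Bijection⇒Inverse) renaming (trans to ⤖-trans)
open import Function.Properties.Inverse using (Inverse⇒Bijection; ↔-sym; ↔-trans; ↔⇒⤖)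
open import Relation.Binary.PropositionalEquality
open import Relation.Nullary using (¬_; yes; does; contradiction)
open import Relation.Nullary.Decidable using (dec-true; dec-false)

-- Counting in finite sets

<ᵇ-true : ∀ {m n} → m < n → (m <ᵇ n) ≡ true
<ᵇ-true = Equivalence.to T-≡ ∘ <⇒<ᵇ

<ᵇ-true⁻¹ : ∀ {m n} → (m <ᵇ n) ≡ true → m < n
<ᵇ-true⁻¹ {m} {n} = <ᵇ⇒< m n ∘ Equivalence.from T-≡

<ᵇ-false⁻¹ : ∀ {m n} → (m <ᵇ n) ≡ false → n ≤ m
<ᵇ-false⁻¹ e = ≮⇒≥ λ m<n → contradiction (trans (sym e) (<ᵇ-true m<n)) λ ()

<ᵇ-false : ∀ {m n} → n ≤ m → (m <ᵇ n) ≡ false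
<ᵇ-false n≤m = ¬-not λ e → <⇒≱ (<ᵇ-true⁻¹ e) n≤m

not-true⁻¹ : ∀ {b} → not b ≡ true → b ≡ false
not-true⁻¹ {false} _ = refl

∧-trueˡ : ∀ {a b} → a ∧ b ≡ true → a ≡ true
∧-trueˡ {true} _ = refl

∧-trueʳ : ∀ {a b} → a ∧ b ≡ true → b ≡ true
∧-trueʳ {true} e = e

∑-cong : ∀ n {f g : Fin n → ℕ} → (∀ i → f i ≡ g i) → ∑ n f ≡ ∑ n g
∑-cong zero    f≗g = refl
∑-cong (suc n) f≗g = cong₂ _+_ (f≗g zero) (∑-cong n (f≗g ∘ suc))

∑-zero : ∀ n → ∑ n (λ _ → 0) ≡ 0
∑-zero zero    = refl
∑-zero (suc n) = ∑-zero n

∑-distrib-+ : ∀ n (f g : Fin n → ℕ) → ∑ n (λ i → f i + g i) ≡ ∑ n f + ∑ n g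
∑-distrib-+ zero    f g = refl
∑-distrib-+ (suc n) f g rewrite ∑-distrib-+ n (f ∘ suc) (g ∘ suc) =
  interchange (f zero) (g zero) _ _
  where
  interchange : ∀ a b c d → a + b + (c + d) ≡ a + c + (b + d)
  interchange = solve-∀

∑-splitAt : ∀ a n (f : Fin (a + n) → ℕ) →
            ∑ (a + n) f ≡ ∑ a (f ∘ (_↑ˡ n)) + ∑ n (f ∘ (a ↑ʳ_))
∑-splitAt zero    n f = refl
∑-splitAt (suc a) n f rewrite ∑-splitAt a n (f ∘ suc) = sym (+-assoc (f zero) _ _)

bit : Bool → ℕ
bit b = if b then 1 else 0

bit-mono : ∀ {b c} → (b ≡ true → c ≡ true) → bit b ≤ bit c
bit-mono {false} _   = z≤n
bit-mono {true}  b⇒c rewrite b⇒c refl = ≤-refl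

count : (n : ℕ) → (Fin n → Bool) → ℕ
count n P = ∑ n (bit ∘ P)

count-cong : ∀ n {P Q : Fin n → Bool} → (∀ i → P i ≡ Q i) → count n P ≡ count n Q
count-cong n P≗Q = ∑-cong n (cong bit ∘ P≗Q)

count-mono : ∀ n {P Q : Fin n → Bool} → (∀ i → P i ≡ true → Q i ≡ true) →
             count n P ≤ count n Q
count-mono zero    P⊆Q = z≤n
count-mono (suc n) P⊆Q = +-mono-≤ (bit-mono (P⊆Q zero)) (count-mono n (P⊆Q ∘ suc))

count-≥ : ∀ a {P : Fin a → Bool} p → p ≤ a → (∀ j → toℕ j < p → P j ≡ true) → p ≤ count a P
count-≥ a       zero    _   _   = z≤n
count-≥ (suc a) (suc p) p≤a <⇒P rewrite <⇒P zero (s≤s z≤n) =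
  s≤s (count-≥ a p (s≤s⁻¹ p≤a) (λ j j<p → <⇒P (suc j) (s≤s j<p)))

count-≤ : ∀ a {P : Fin a → Bool} p → (∀ j → P j ≡ true → toℕ j < p) → count a P ≤ p
count-≤ zero    p _ = z≤n
count-≤ (suc a) {P} p P⇒< with P zero in e
count-≤ (suc a) p P⇒<       | false = count-≤ a p (λ j → <-trans (n<1+n _) ∘ P⇒< (suc j))
count-≤ (suc a) (suc p) P⇒< | true  = s≤s (count-≤ a p (λ j → s≤s⁻¹ ∘ P⇒< (suc j)))
count-≤ (suc a) zero P⇒<    | true  with () ← P⇒< zero e

count-∃ : ∀ n {P Q : Fin n → Bool} → count n P < count n Q → ∃ λ j → Q j ≡ true × P j ≡ false
count-∃ (suc n) {P} {Q} lt with P zero in eP | Q zero in eQ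
... | false | true  = zero , eQ , eP
... | false | false = let j , q , p = count-∃ n lt in suc j , q , p
... | true  | true  = let j , q , p = count-∃ n (s≤s⁻¹ lt) in suc j , q , p
... | true  | false = let j , q , p = count-∃ n (<-trans (n<1+n _) lt) in suc j , q , p

count-pos : ∀ n {P : Fin n → Bool} j → P j ≡ true → 1 ≤ count n P
count-pos (suc n) zero    Pj rewrite Pj = s≤s z≤n
count-pos (suc n) (suc j) Pj = ≤-trans (count-pos n j Pj) (m≤n+m _ _)

count-singleton : ∀ n (i : Fin n) → count n (λ j → does (j ≟ᶠ i)) ≡ 1
count-singleton (suc n) zero    = cong suc (∑-zero n)
count-singleton (suc n) (suc i) = count-singleton n i

least : ∀ n (P : Fin n → Bool) →
        (∃ λ p → P p ≡ true × ∀ j → toℕ j < toℕ p → P j ≡ false) ⊎ (∀ j → P j ≡ false)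
least zero    P = inj₂ λ ()
least (suc n) P with P zero in e
... | true = inj₁ (zero , e , λ _ ())
... | false with least n (P ∘ suc)
...   | inj₁ (p , Pp , below) =
        inj₁ (suc p , Pp , λ { zero _ → e ; (suc j) lt → below j (s≤s⁻¹ lt) })
...   | inj₂ none = inj₂ λ { zero → e ; (suc j) → none j }

↑-elim : ∀ a n (P : Fin (a + n) → Set) → (∀ p → P (p ↑ˡ n)) → (∀ q → P (a ↑ʳ q)) → ∀ u → P u
↑-elim a n P l r u with splitAt a u | join-splitAt a n u
... | inj₁ p | refl = l p
... | inj₂ q | refl = r q

-- Decompositions of parking functions on an arbitrary graph

module _ (G : Graph) where
  open Graph G

  -- As S lies in the complement B of A, the vertices outside S are A together with the sink and the
  -- rest of B. `emb` omits the sink, so it is counted once.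
  deg-disjoint-∪ : ∀ (A S : NSubset G) → _⊆_ G S (compl G A) → ∀ v →
    deg G (withSinkMinus G (allN G) S) v
      ≡ deg G (emb G A) v + deg G (withSinkMinus G (compl G A) S) v
  deg-disjoint-∪ A S S⊆B v = trans (∑-cong (suc k) pointwise) (∑-distrib-+ (suc k)
    (λ w → if emb G A w then mult v w else 0)
    (λ w → if withSinkMinus G (compl G A) S w then mult v w else 0))
    where
    pointwise : ∀ w → (if withSinkMinus G (allN G) S w then mult v w else 0)
      ≡ (if emb G A w then mult v w else 0)
        + (if withSinkMinus G (compl G A) S w then mult v w else 0)
    pointwise zero = refl
    pointwise (suc u) with A u in eA | S u in eS
    ... | false | _     = refl
    ... | true  | false = sym (+-identityʳ _)
    ... | true  | true  with () ← trans (sym (cong not eA)) (S⊆B u eS)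

  -- Burning of f^B is inherited from f, since value and degree both drop by deg^A. For a candidate
  -- A this leaves the parking condition on A and positivity of f^B.
  decomposable : ∀ {f} (A : NSubset G) → IsPF G f → IsPFOn G A f →
    (∀ u → A u ≡ false → deg G (emb G A) (suc u) < f u) → Decomposable G f A
  decomposable {f} A (_ , pf) pfA big = pfA , positive , burns
    where
    positive : ∀ u → compl G A u ≡ true → 1 ≤ restB G A f u
    positive u u∈B = m<n⇒0<n∸m (big u (not-true⁻¹ u∈B))

    burns : ∀ S → _⊆_ G S (compl G A) → NonEmpty G S →
      ∃ λ u → S u ≡ true × restB G A f u ≤ deg G (withSinkMinus G (compl G A) S) (suc u)
    burns S S⊆B S≢∅ = let u , u∈S , fu≤ = pf S (λ _ _ → refl) S≢∅ in
      u , u∈S , m≤n+o⇒m∸n≤o (f u) (deg G (emb G A) (suc u)) (subst (f u ≤_) (deg-disjoint-∪ A S S⊆B (suc u)) fu≤)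

-- Degrees and parking functions on complete split graphs

module _ (a n : ℕ) where

  private
    G : Graph
    G = Split a n

  toℕ-↑ˡ< : ∀ (p : Fin a) → (toℕ (p ↑ˡ n) <ᵇ a) ≡ true
  toℕ-↑ˡ< p rewrite toℕ-↑ˡ p n = <ᵇ-true (toℕ<n p)

  toℕ-↑ʳ≮ : ∀ (q : Fin n) → (toℕ (a ↑ʳ q) <ᵇ a) ≡ false
  toℕ-↑ʳ≮ q rewrite toℕ-↑ʳ a q = <ᵇ-false (m≤m+n a (toℕ q))

  ↑ˡ≢↑ʳ : ∀ {p : Fin a} {q : Fin n} → p ↑ˡ n ≢ a ↑ʳ q
  ↑ˡ≢↑ʳ {p} {q} e = <⇒≢ (<-≤-trans (toℕ<n p) (m≤m+n a (toℕ q)))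
    (trans (sym (toℕ-↑ˡ p n)) (trans (cong toℕ e) (toℕ-↑ʳ a q)))

  mult-sink : ∀ u → splitMult a n (suc u) zero ≡ 1
  mult-sink u rewrite ∨-zeroʳ (toℕ u <ᵇ a) = refl

  mult-clique : ∀ p w → p ↑ˡ n ≢ w → splitMult a n (suc (p ↑ˡ n)) (suc w) ≡ 1
  mult-clique p w p≢w
    rewrite toℕ-↑ˡ< p | dec-false (Fin.suc (p ↑ˡ n) ≟ᶠ suc w) (p≢w ∘ suc-injective) = refl

  mult-indep-clique : ∀ q p → splitMult a n (suc (a ↑ʳ q)) (suc (p ↑ˡ n)) ≡ 1
  mult-indep-clique q p
    rewrite dec-false (Fin.suc (a ↑ʳ q) ≟ᶠ suc (p ↑ˡ n)) (↑ˡ≢↑ʳ ∘ sym ∘ suc-injective)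
          | toℕ-↑ˡ< p
          | ∨-zeroʳ (toℕ (a ↑ʳ q) <ᵇ a) = refl

  mult-indep-indep : ∀ q r → splitMult a n (suc (a ↑ʳ q)) (suc (a ↑ʳ r)) ≡ 0
  mult-indep-indep q r rewrite toℕ-↑ʳ≮ q | toℕ-↑ʳ≮ r
    with does (Fin.suc (a ↑ʳ q) ≟ᶠ suc (a ↑ʳ r))
  ... | true  = refl
  ... | false = refl

  -- A clique vertex is adjacent to all vertices except itself, so plain counting is correct when W
  -- omits it.
  deg-clique : ∀ (W : VSubset G) p → W (suc (p ↑ˡ n)) ≡ false →
    deg G W (suc (p ↑ˡ n)) ≡
      bit (W zero) + (count a (λ j → W (suc (j ↑ˡ n))) + count n (λ q → W (suc (a ↑ʳ q))))
  deg-clique W p Wp = cong₂ _+_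
    (cong (λ x → if W zero then x else 0) (mult-sink (p ↑ˡ n)))
    (trans (∑-cong (a + n) term) (∑-splitAt a n _))
    where
    term : ∀ w → (if W (suc w) then splitMult a n (suc (p ↑ˡ n)) (suc w) else 0) ≡ bit (W (suc w))
    term w with W (suc w) in e
    ... | false = refl
    ... | true  = mult-clique p w λ { refl → contradiction (trans (sym e) Wp) λ () }

  deg-indep : ∀ (W : VSubset G) q →
    deg G W (suc (a ↑ʳ q)) ≡ bit (W zero) + count a (λ j → W (suc (j ↑ˡ n)))
  deg-indep W q = cong₂ _+_
    (cong (λ x → if W zero then x else 0) (mult-sink (a ↑ʳ q)))
    (begin
      ∑ (a + n) (λ w → if W (suc w) then splitMult a n (suc (a ↑ʳ q)) (suc w) else 0)
        ≡⟨ ∑-splitAt a n _ ⟩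
      ∑ a (λ j → if W (suc (j ↑ˡ n)) then splitMult a n (suc (a ↑ʳ q)) (suc (j ↑ˡ n)) else 0)
        + ∑ n (λ r → if W (suc (a ↑ʳ r)) then splitMult a n (suc (a ↑ʳ q)) (suc (a ↑ʳ r)) else 0)
        ≡⟨ cong₂ _+_
             (∑-cong a λ j → cong (λ x → if W (suc (j ↑ˡ n)) then x else 0) (mult-indep-clique q j))
             (trans (∑-cong n vanish) (∑-zero n)) ⟩
      count a (λ j → W (suc (j ↑ˡ n))) + 0
        ≡⟨ +-identityʳ _ ⟩
      count a (λ j → W (suc (j ↑ˡ n))) ∎)
    where
    open ≡-Reasoning
    vanish : ∀ r → (if W (suc (a ↑ʳ r)) then splitMult a n (suc (a ↑ʳ q)) (suc (a ↑ʳ r)) else 0) ≡ 0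
    vanish r rewrite mult-indep-indep q r with W (suc (a ↑ʳ r))
    ... | true  = refl
    ... | false = refl

  -- If v^c_{p+1} is the first clique vertex of S, either some independent vertex of S has
  -- value ≤ 1 + p and burns, or all such vertices of A are outside S and v^c_{p+1} burns.
  isPFOn : ∀ {f} (A : NSubset G) t → t ≤ a →
    (∀ j → toℕ j < t → A (j ↑ˡ n) ≡ true) →
    (∀ j → A (j ↑ˡ n) ≡ true → toℕ j < t) →
    (∀ u → A u ≡ true → 1 ≤ f u) →
    (∀ q → A (a ↑ʳ q) ≡ true → f (a ↑ʳ q) ≤ suc t) →
    (∀ j → toℕ j < t →
       f (j ↑ˡ n) ≤ suc (toℕ j) + count n (λ q → A (a ↑ʳ q) ∧ (f (a ↑ʳ q) <ᵇ suc (suc (toℕ j))))) →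
    IsPFOn G A f
  isPFOn {f} A t t≤a <⇒A A⇒< pos indep clique = pos , burns
    where
    W : NSubset G → VSubset G
    W = withSinkMinus G A

    W-intro : ∀ S u → A u ≡ true → S u ≡ false → W S (suc u) ≡ true
    W-intro S u Au Su rewrite Au | Su = refl

    burns : ∀ S → _⊆_ G S A → NonEmpty G S → ∃ λ u → S u ≡ true × f u ≤ deg G (W S) (suc u)
    burns S S⊆A (u , Su) with least a (S ∘ (_↑ˡ n))
    -- S has no clique vertex, so each of its vertices is independent, sees the sink and all t
    -- clique vertices of A, and burns.
    ... | inj₂ none = ↑-elim a n P (λ p Sp → contradiction (trans (sym Sp) (none p)) λ ())
        (λ q Sq → a ↑ʳ q , Sq , (begin
          f (a ↑ʳ q)                 ≤⟨ indep q (S⊆A _ Sq) ⟩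
          suc t                      ≤⟨ s≤s (count-≥ a t t≤a λ j j<t → W-intro S _ (<⇒A j j<t) (none j)) ⟩
          suc (count a (λ j → W S (suc (j ↑ˡ n))))  ≡⟨ deg-indep (W S) q ⟨
          deg G (W S) (suc (a ↑ʳ q)) ∎)) u Su
      where
      open ≤-Reasoning
      P : Fin (a + n) → Set
      P u = S u ≡ true → ∃ λ u → S u ≡ true × f u ≤ deg G (W S) (suc u)
    ... | inj₁ (p , Sp , below)
        with least n (λ q → S (a ↑ʳ q) ∧ (f (a ↑ʳ q) <ᵇ suc (suc (toℕ p))))
    ...   | inj₁ (q , hq , _) = a ↑ʳ q , ∧-trueˡ hq , (begin
          f (a ↑ʳ q)                 ≤⟨ s≤s⁻¹ (<ᵇ-true⁻¹ (∧-trueʳ {S (a ↑ʳ q)} hq)) ⟩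
          suc (toℕ p)                ≤⟨ s≤s p≤count ⟩
          suc (count a (λ j → W S (suc (j ↑ˡ n)))) ≡⟨ deg-indep (W S) q ⟨
          deg G (W S) (suc (a ↑ʳ q)) ∎)
      where
      open ≤-Reasoning
      p≤count : toℕ p ≤ count a (λ j → W S (suc (j ↑ˡ n)))
      p≤count = count-≥ a (toℕ p) (<⇒≤ (toℕ<n p)) λ j j<p →
        W-intro S _ (<⇒A j (<-trans j<p (A⇒< p (S⊆A _ Sp)))) (below j j<p)
    ...   | inj₂ none = p ↑ˡ n , Sp , (begin
          f (p ↑ˡ n)                 ≤⟨ clique p (A⇒< p (S⊆A _ Sp)) ⟩
          suc (toℕ p) + _            ≤⟨ s≤s (+-mono-≤ p≤count (count-mono n unburnt)) ⟩
          suc (count a (λ j → W S (suc (j ↑ˡ n))) + count n (λ q → W S (suc (a ↑ʳ q))))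
                                     ≡⟨ deg-clique (W S) p Wp ⟨
          deg G (W S) (suc (p ↑ˡ n)) ∎)
      where
      open ≤-Reasoning
      p≤count : toℕ p ≤ count a (λ j → W S (suc (j ↑ˡ n)))
      p≤count = count-≥ a (toℕ p) (<⇒≤ (toℕ<n p)) λ j j<p →
        W-intro S _ (<⇒A j (<-trans j<p (A⇒< p (S⊆A _ Sp)))) (below j j<p)
      Wp : W S (suc (p ↑ˡ n)) ≡ false
      Wp rewrite Sp = ∧-zeroʳ _
      unburnt : ∀ q → A (a ↑ʳ q) ∧ (f (a ↑ʳ q) <ᵇ suc (suc (toℕ p))) ≡ true →
                W S (suc (a ↑ʳ q)) ≡ true
      unburnt q h with S (a ↑ʳ q) | none q
      ... | false | _ = cong (_∧ true) (∧-trueˡ {A (a ↑ʳ q)} h)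
      ... | true  | e = contradiction (trans (sym e) (∧-trueʳ {A (a ↑ʳ q)} h)) λ ()

-- Increasing parking functions as inequalities

-- `<ᵇ suc (suc (toℕ p))` means value at most 1 + p, the degree of an independent vertex towards the
-- sink and the first p clique vertices. Monotonicity is kept apart; it enters when the bounds are
-- derived from the parking property.
record Bounded (a n : ℕ) (f : Fin (a + n) → ℕ) : Set where
  constructor bounded
  field
    positive : ∀ u → 1 ≤ f u
    indep    : ∀ q → f (a ↑ʳ q) ≤ suc a
    clique   : ∀ p → f (p ↑ˡ n) ≤
               suc (toℕ p) + count n (λ q → f (a ↑ʳ q) <ᵇ suc (suc (toℕ p)))

bounded⇒isPF : ∀ {a n f} → Bounded a n f → IsPF (Split a n) f
bounded⇒isPF {a} {n} (bounded pos indep clique) =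
  isPFOn a n (λ _ → true) a ≤-refl (λ _ _ → refl) (λ j _ → toℕ<n j)
    (λ u _ → pos u) (λ q _ → indep q) (λ p _ → clique p)

increasing-clique : ∀ {a n f} → IsIncreasing a n f → ∀ {p r : Fin a} → toℕ p ≤ toℕ r →
                    f (p ↑ˡ n) ≤ f (r ↑ˡ n)
increasing-clique {a} {n} inc {p} {r} p≤r = inc _ _
  (subst₂ _≤_ (sym (toℕ-↑ˡ p n)) (sym (toℕ-↑ˡ r n)) p≤r)
  (inj₁ (subst (_< a) (sym (toℕ-↑ˡ r n)) (toℕ<n r)))

increasing-indep : ∀ {a n f} → IsIncreasing a n f → ∀ {q r : Fin n} → toℕ q ≤ toℕ r →
                   f (a ↑ʳ q) ≤ f (a ↑ʳ r)
increasing-indep {a} {n} inc {q} {r} q≤r = inc _ _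
  (subst₂ _≤_ (sym (toℕ-↑ʳ a q)) (sym (toℕ-↑ʳ a r)) (+-monoʳ-≤ a q≤r))
  (inj₂ (subst (a ≤_) (sym (toℕ-↑ʳ a q)) (m≤m+n a (toℕ q))))

-- Each bound comes from a test set. For an independent vertex it is the singleton. For v^c_{p+1} it
-- consists of the clique vertices from it on and the independent vertices of value above 1 + p: if
-- the bound failed, nothing there could burn, as by monotonicity all these clique values are too
-- large as well.
isPF⇒bounded : ∀ {a n f} → IsIncreasing a n f → IsPF (Split a n) f → Bounded a n f
isPF⇒bounded {a} {n} {f} inc (pos , pf) = bounded (λ u → pos u refl) indep clique
  where
  G′ : Graph
  G′ = Split a n

  indep : ∀ q → f (a ↑ʳ q) ≤ suc a
  indep q with pf S (λ _ _ → refl) (a ↑ʳ q , dec-true (a ↑ʳ q ≟ᶠ a ↑ʳ q) refl)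
    where
    S : NSubset G′
    S u = does (u ≟ᶠ a ↑ʳ q)
  ... | u , Su , fu≤ with yes refl ← u ≟ᶠ a ↑ʳ q = ≤-trans
    (subst (f u ≤_) (deg-indep a n (withSinkMinus G′ (allN G′) λ w → does (w ≟ᶠ a ↑ʳ q)) q) fu≤)
    (s≤s (count-≤ a a (λ j _ → toℕ<n j)))

  clique : ∀ p → f (p ↑ˡ n) ≤ suc (toℕ p) + count n (λ q → f (a ↑ʳ q) <ᵇ suc (suc (toℕ p)))
  clique p = ≮⇒≥ impossible
    where
    late : Fin a → Bool
    late j = not (toℕ j <ᵇ toℕ p)
    large : Fin n → Bool
    large q = not (f (a ↑ʳ q) <ᵇ suc (suc (toℕ p)))
    S : NSubset G′
    S = late ++ large
    S-↑ˡ : ∀ j → S (j ↑ˡ n) ≡ late j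
    S-↑ˡ = lookup-++ˡ late large
    S-↑ʳ : ∀ q → S (a ↑ʳ q) ≡ large q
    S-↑ʳ = lookup-++ʳ late large
    W : VSubset G′
    W = withSinkMinus G′ (allN G′) S
    not-not : ∀ {b c} → b ≡ not c → not b ≡ true → c ≡ true
    not-not {c = true} _ _ = refl
    not-not {c = false} refl ()
    countC : count a (λ j → W (suc (j ↑ˡ n))) ≤ toℕ p
    countC = count-≤ a (toℕ p) λ j h → <ᵇ-true⁻¹ (not-not (S-↑ˡ j) h)
    countI : count n (λ q → W (suc (a ↑ʳ q))) ≤ count n (λ q → f (a ↑ʳ q) <ᵇ suc (suc (toℕ p)))
    countI = count-mono n λ q h → not-not (S-↑ʳ q) h
    p∈S : S (p ↑ˡ n) ≡ true
    p∈S = trans (S-↑ˡ p) (cong not (<ᵇ-false {toℕ p} ≤-refl))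
    impossible : ¬ (suc (toℕ p) + count n (λ q → f (a ↑ʳ q) <ᵇ suc (suc (toℕ p))) < f (p ↑ˡ n))
    impossible big with u , Su , fu≤ ← pf S (λ _ _ → refl) (p ↑ˡ n , p∈S) =
      ↑-elim a n (λ u → S u ≡ true → f u ≤ deg G′ W (suc u) → ⊥)
        (λ j Sj fj≤ → <⇒≱ big (≤-trans
          (increasing-clique inc (<ᵇ-false⁻¹ (not-true⁻¹ (trans (sym (S-↑ˡ j)) Sj))))
          (≤-trans fj≤ (≤-trans (≤-reflexive (deg-clique a n W j (cong not Sj)))
                                (s≤s (+-mono-≤ countC countI))))))
        (λ q Sq fq≤ → <⇒≱ (<ᵇ-false⁻¹ (not-true⁻¹ (trans (sym (S-↑ʳ q)) Sq)))
          (≤-trans fq≤ (≤-trans (≤-reflexive (deg-indep a n W q)) (s≤s countC))))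
        u Su fu≤

-- Prime parking functions

module _ {k n : ℕ} {f : Fin (suc k + n) → ℕ} where
  private
    G′ : Graph
    G′ = Split (suc k) n

    smaller : ℕ → ℕ
    smaller t = count n (λ q → f (suc k ↑ʳ q) <ᵇ t)

  -- The candidate decompositions are along the initial segments of the greedy
  -- burning order: the first p clique vertices together with all v^i of value ≤ p.
  prime⇒¬gap : IsPPF G′ f → Bounded (suc k) n f → ∀ p → 1 ≤ p → p ≤ suc k →
    (∀ j → p ≤ toℕ j → p + smaller (suc p) < f (j ↑ˡ n)) →
    (∃ λ j → p ≤ toℕ {suc k} j) ⊎ (∃ λ q → p < f (suc k ↑ʳ q)) → ⊥
  prime⇒¬gap (pf , prime) (bounded pos indep clique) p 1≤p p≤m gap rest =
    prime A (zero , trans (A-↑ˡ zero) (<ᵇ-true 1≤p)) (B≢∅ rest) (decomposable G′ A pf pfA big)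
    where
    early : Fin (suc k) → Bool
    early j = toℕ j <ᵇ p
    small : Fin n → Bool
    small q = f (suc k ↑ʳ q) <ᵇ suc p
    A : NSubset G′
    A = early ++ small
    A-↑ˡ : ∀ j → A (j ↑ˡ n) ≡ early j
    A-↑ˡ = lookup-++ˡ early small
    A-↑ʳ : ∀ q → A (suc k ↑ʳ q) ≡ small q
    A-↑ʳ = lookup-++ʳ early small
    B≢∅ : (∃ λ j → p ≤ toℕ {suc k} j) ⊎ (∃ λ q → p < f (suc k ↑ʳ q)) → NonEmpty G′ (compl G′ A)
    B≢∅ (inj₁ (j , p≤j)) = j ↑ˡ n , cong not (trans (A-↑ˡ j) (<ᵇ-false p≤j))
    B≢∅ (inj₂ (q , p<f)) = suc k ↑ʳ q , cong not (trans (A-↑ʳ q) (<ᵇ-false p<f))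
    pfA : IsPFOn G′ A f
    pfA = isPFOn (suc k) n A p p≤m
      (λ j j<p → trans (A-↑ˡ j) (<ᵇ-true j<p))
      (λ j Aj → <ᵇ-true⁻¹ (trans (sym (A-↑ˡ j)) Aj))
      (λ u _ → pos u)
      (λ q Aq → m≤n⇒m≤1+n (s≤s⁻¹ (<ᵇ-true⁻¹ (trans (sym (A-↑ʳ q)) Aq))))
      -- Independent vertices counted in the bound for j have value at most 1 + j ≤ p, hence lie in
      -- A: restricting the count to A loses nothing.
      (λ j j<p → ≤-trans (clique j) (+-monoʳ-≤ (suc (toℕ j)) (count-mono n λ q lt →
        cong₂ _∧_ (trans (A-↑ʳ q) (<ᵇ-true (≤-trans (<ᵇ-true⁻¹ {f (suc k ↑ʳ q)} lt) (s≤s j<p)))) lt)))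
    countC : count (suc k) (λ j → A (j ↑ˡ n)) ≤ p
    countC = count-≤ (suc k) p λ j Aj → <ᵇ-true⁻¹ (trans (sym (A-↑ˡ j)) Aj)
    -- A does not contain the sink, so the degrees into A are at most p + N(p) on the clique and p
    -- on the independent vertices, without a further 1.
    big : ∀ u → A u ≡ false → deg G′ (emb G′ A) (suc u) < f u
    big = ↑-elim (suc k) n (λ u → A u ≡ false → deg G′ (emb G′ A) (suc u) < f u)
      (λ j Aj → ≤-<-trans
        (≤-trans (≤-reflexive (deg-clique (suc k) n (emb G′ A) j Aj))
                 (+-mono-≤ countC (count-mono n λ q → trans (sym (A-↑ʳ q)))))
        (gap j (<ᵇ-false⁻¹ (trans (sym (A-↑ˡ j)) Aj))))
      (λ q Aq → ≤-<-trans
        (≤-trans (≤-reflexive (deg-indep (suc k) n (emb G′ A) q)) countC)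
        (<ᵇ-false⁻¹ (trans (sym (A-↑ʳ q)) Aq)))

  -- If c_0 ≥ 2, some independent vertex has value 1, and this vertex alone forms a decomposing A:
  -- it is adjacent to the sink, clique values drop by one but stay positive by monotonicity, and
  -- the other independent values do not change.
  prime⇒first≤1 : IsIncreasing (suc k) n f → IsPPF G′ f → Bounded (suc k) n f → f zero ≤ 1
  prime⇒first≤1 inc (pf , prime) (bounded pos indep clique) = ≮⇒≥ impossible
    where
    impossible : ¬ (1 < f zero)
    impossible 1<f0 = prime A (suc k ↑ʳ q , dec-true (v ≟ᶠ v) refl) (zero , refl)
                        (decomposable G′ A pf pfA big)
      where
      one : ∃ λ q → (f (suc k ↑ʳ q) <ᵇ 2) ≡ true × false ≡ false
      -- The clique bound at p = 0 reads c_0 ≤ 1 + N(1), so N(1) > 0; comparison with the constantly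
      -- false predicate extracts a witness.
      one = count-∃ n (subst (_< smaller 2) (sym (∑-zero n)) (s≤s⁻¹ (≤-trans 1<f0 (clique zero))))
      q : Fin n
      q = proj₁ one
      v : Fin (suc k + n)
      v = suc k ↑ʳ q
      A : NSubset G′
      A u = does (u ≟ᶠ v)
      A⇒≡ : ∀ u → A u ≡ true → u ≡ v
      A⇒≡ u Au with yes e ← u ≟ᶠ v = e
      A-↑ˡ : ∀ j → A (j ↑ˡ n) ≡ false
      A-↑ˡ j = dec-false (j ↑ˡ n ≟ᶠ v) (↑ˡ≢↑ʳ (suc k) n)
      A-↑ʳ : ∀ r → A (suc k ↑ʳ r) ≡ true → does (r ≟ᶠ q) ≡ true
      A-↑ʳ r Ar = dec-true (r ≟ᶠ q) (↑ʳ-injective (suc k) r q (A⇒≡ _ Ar))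
      A-clique : ∀ j → A (j ↑ˡ n) ≡ true → toℕ j < 0
      A-clique j Aj = contradiction (trans (sym Aj) (A-↑ˡ j)) λ ()
      countC : count (suc k) (λ j → A (j ↑ˡ n)) ≤ 0
      countC = count-≤ (suc k) 0 A-clique
      countI : count n (λ r → A (suc k ↑ʳ r)) ≤ 1
      countI = ≤-trans (count-mono n A-↑ʳ) (≤-reflexive (count-singleton n q))
      pfA : IsPFOn G′ A f
      pfA = isPFOn (suc k) n A 0 z≤n (λ _ ()) A-clique (λ u _ → pos u)
        (λ r Ar → subst (λ u → f u ≤ 1) (sym (A⇒≡ _ Ar)) (s≤s⁻¹ (<ᵇ-true⁻¹ (proj₁ (proj₂ one)))))
        (λ _ ())
      big : ∀ u → A u ≡ false → deg G′ (emb G′ A) (suc u) < f u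
      big = ↑-elim (suc k) n (λ u → A u ≡ false → deg G′ (emb G′ A) (suc u) < f u)
        (λ j Aj → ≤-<-trans
          (≤-trans (≤-reflexive (deg-clique (suc k) n (emb G′ A) j Aj)) (+-mono-≤ countC countI))
          (≤-trans 1<f0 (increasing-clique inc {zero} {j} z≤n)))
        (λ r _ → ≤-<-trans
          (≤-trans (≤-reflexive (deg-indep (suc k) n (emb G′ A) r)) countC)
          (pos _))

  -- A violated bound of the tail is a gap. For an independent value above k + 1, take all clique
  -- vertices into A, which makes the gap condition vacuous. For a clique value, monotonicity
  -- carries the violation to all later clique vertices.
  prime⇒tail-bounded : IsIncreasing (suc k) n f → IsPPF G′ f → Bounded k n (f ∘ suc)
  prime⇒tail-bounded inc ppf = bounded (positive ∘ suc) indep′ clique′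
    where
    bd : Bounded (suc k) n f
    bd = isPF⇒bounded inc (proj₁ ppf)
    open Bounded bd
    indep′ : ∀ q → f (suc k ↑ʳ q) ≤ suc k
    indep′ q = ≮⇒≥ λ big → prime⇒¬gap ppf bd (suc k) (s≤s z≤n) ≤-refl
      (λ j k<j → contradiction k<j (<⇒≱ (toℕ<n j))) (inj₂ (q , big))
    clique′ : ∀ p → f (suc p ↑ˡ n) ≤ suc (toℕ p) + smaller (suc (suc (toℕ p)))
    clique′ p = ≮⇒≥ λ big → prime⇒¬gap ppf bd (suc (toℕ p)) (s≤s z≤n) (<⇒≤ (s≤s (toℕ<n p)))
      (λ j p<j → <-≤-trans big (increasing-clique inc {suc p} {j} p<j)) (inj₁ (suc p , ≤-refl))

  -- Let v^c_{p+1} be the first clique vertex outside A.  Positivity of f^B there forces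
  -- more than |A ∩ I| independent vertices of value ≤ p, but one of these is outside A,
  -- where f^B is positive only for values > |A ∩ C| ≥ p.
  tail-bounded⇒prime : f zero ≡ 1 → Bounded k n (f ∘ suc) → IsPPF G′ f
  tail-bounded⇒prime f0≡1 (bounded pos indep clique) = bounded⇒isPF bd , prime
    where
    pos′ : ∀ u → 1 ≤ f u
    pos′ zero    = ≤-reflexive (sym f0≡1)
    pos′ (suc u) = pos u
    clique′ : ∀ p → f (p ↑ˡ n) ≤ suc (toℕ p) + smaller (suc (suc (toℕ p)))
    clique′ zero    = ≤-trans (≤-reflexive f0≡1) (s≤s z≤n)
    clique′ (suc p) = ≤-trans (clique p) (+-mono-≤ (n≤1+n _)
      (count-mono n λ q lt → <ᵇ-true (m<n⇒m<1+n (<ᵇ-true⁻¹ {f (suc k ↑ʳ q)} lt))))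
    bd : Bounded (suc k) n f
    bd = bounded pos′ (m≤n⇒m≤1+n ∘ indep) clique′

    prime : ∀ A → NonEmpty G′ A → NonEmpty G′ (compl G′ A) → ¬ Decomposable G′ f A
    prime A (u , Au) (w , Bw) (_ , posB , _) = case (least (suc k) (λ j → not (A (j ↑ˡ n))))
      where
      big : ∀ u → A u ≡ false → deg G′ (emb G′ A) (suc u) < f u
      big u Au = m∸n≢0⇒n<m λ e → contradiction (subst (1 ≤_) e (posB u (cong not Au))) λ ()
      big-indep : ∀ q → A (suc k ↑ʳ q) ≡ false → count (suc k) (λ j → A (j ↑ˡ n)) < f (suc k ↑ʳ q)
      big-indep q Aq = ≤-<-trans (≤-reflexive (sym (deg-indep (suc k) n (emb G′ A) q))) (big _ Aq)
      not-false⁻¹ : ∀ {b} → not b ≡ false → b ≡ true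
      not-false⁻¹ {true} _ = refl

      case : (∃ λ p → not (A (p ↑ˡ n)) ≡ true × ∀ j → toℕ j < toℕ p → not (A (j ↑ˡ n)) ≡ false)
             ⊎ (∀ j → not (A (j ↑ˡ n)) ≡ false) → ⊥
      -- All clique vertices are in A, so a vertex of B is independent and positivity of f^B would
      -- require a value above k + 1.
      case (inj₂ all) = ↑-elim (suc k) n (λ w → compl G′ A w ≡ true → ⊥)
        (λ j Bj → contradiction (trans (sym Bj) (all j)) λ ())
        (λ q Bq → <⇒≱ (big-indep q (not-true⁻¹ Bq))
          (≤-trans (indep q) (count-≥ (suc k) (suc k) ≤-refl λ j _ → not-false⁻¹ (all j))))
        w Bw
      case (inj₁ (p , Bp , below)) with big-p ← subst (_< f (p ↑ˡ n))
             (deg-clique (suc k) n (emb G′ A) p (not-true⁻¹ Bp)) (big _ (not-true⁻¹ Bp)) | p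
      -- Here v^c_1 is in B with value 1, but it is adjacent to every vertex of the non-empty A, so
      -- f^B is not positive there.
      ... | zero = <⇒≱ (≤-trans big-p (≤-reflexive f0≡1)) (↑-elim (suc k) n
        (λ u → A u ≡ true → 1 ≤ count (suc k) (λ j → A (j ↑ˡ n)) + count n (λ q → A (suc k ↑ʳ q)))
        (λ j Aj → ≤-trans (count-pos (suc k) {λ j → A (j ↑ˡ n)} j Aj) (m≤m+n _ _))
        (λ q Aq → ≤-trans (count-pos n q Aq) (m≤n+m _ (count (suc k) (λ j → A (j ↑ˡ n))))) u Au)
      ... | suc p′ = let q , lt , Aq = count-∃ n more in
        <⇒≱ (big-indep q Aq) (≤-trans (s≤s⁻¹ (<ᵇ-true⁻¹ {f (suc k ↑ʳ q)} lt)) p≤count)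
        where
        p≤count : suc (toℕ p′) ≤ count (suc k) (λ j → A (j ↑ˡ n))
        p≤count = count-≥ (suc k) (suc (toℕ p′)) (<⇒≤ (toℕ<n (suc p′))) λ j j<p → not-false⁻¹ (below j j<p)
        more : count n (λ q → A (suc k ↑ʳ q)) < smaller (suc (suc (toℕ p′)))
        more = +-cancelˡ-< (suc (toℕ p′)) _ _ (≤-<-trans (+-monoˡ-≤ _ p≤count) (<-≤-trans big-p (clique p′)))

-- Dyck words with inserted letters H, and their decoding

-- Words in D, U, H with x + d letters U, d letters D and h letters H, in which
-- the (x + p)-th letter U is preceded by the p-th letter D (counting from 0).
data Path : ℕ → ℕ → ℕ → Set where
  ε  : Path 0 0 0
  D_ : ∀ {x d h} → Path (suc x) d h → Path x (suc d) h
  U_ : ∀ {x d h} → Path x d h → Path (suc x) d h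
  H_ : ∀ {x d h} → Path x d h → Path x d (suc h)

-- γ w p is the number of letters U, H before the p-th D, and ι w q the number of
-- letters U before the q-th H.
γ : ∀ {x d h} → Path x d h → Fin d → ℕ
γ (D w) zero    = 0
γ (D w) (suc p) = γ w p
γ (U w) p       = suc (γ w p)
γ (H w) p       = suc (γ w p)

ι : ∀ {x d h} → Path x d h → Fin h → ℕ
ι (D w) q       = ι w q
ι (U w) q       = suc (ι w q)
ι (H w) zero    = 0
ι (H w) (suc q) = ι w q

-- For x = 0 these are monotonicity and the bounds of `Bounded` with all values lowered by one;
-- general x makes them stable under deleting the first letter. The right side of `g≤` is the number
-- of letters U, H before the (x + p)-th U, so `g≤` says that the p-th D precedes that U.
record Admissible (x d h : ℕ) (g : Fin d → ℕ) (i : Fin h → ℕ) : Set where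
  constructor admissible
  field
    g-mono : ∀ p r → toℕ p ≤ toℕ r → g p ≤ g r
    i-mono : ∀ q r → toℕ q ≤ toℕ r → i q ≤ i r
    i≤     : ∀ q → i q ≤ x + d
    g≤     : ∀ p → g p ≤ x + toℕ p + count h (λ q → i q <ᵇ suc (x + toℕ p))

path-admissible : ∀ {x d h} (w : Path x d h) → Admissible x d h (γ w) (ι w)
path-admissible ε = admissible (λ ()) (λ ()) (λ ()) (λ ())
path-admissible {x} {suc d} {h} (D w) = admissible
  (λ { zero _ _ → z≤n ; (suc p) (suc r) p≤r → g-mono p r (s≤s⁻¹ p≤r) })
  i-mono
  (λ q → subst (ι w q ≤_) (sym (+-suc x d)) (i≤ q))
  (λ { zero    → z≤n
     ; (suc p) → subst (λ t → γ w p ≤ t + count h (λ q → ι w q <ᵇ suc t))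
                       (sym (+-suc x (toℕ p))) (g≤ p) })
  where open Admissible (path-admissible w)
path-admissible (U w) = admissible
  (λ p r → s≤s ∘ g-mono p r) (λ q r → s≤s ∘ i-mono q r) (s≤s ∘ i≤) (s≤s ∘ g≤)
  where open Admissible (path-admissible w)
path-admissible {x} (H w) = admissible
  (λ p r → s≤s ∘ g-mono p r)
  (λ { zero _ _ → z≤n ; (suc q) (suc r) q≤r → i-mono q r (s≤s⁻¹ q≤r) })
  (λ { zero → z≤n ; (suc q) → i≤ q })
  -- The new H has no U before it, so it adds one to the count, matching the increase of `γ`.
  (λ p → subst (suc (γ w p) ≤_) (sym (+-suc (x + toℕ p) _)) (s≤s (g≤ p)))
  where open Admissible (path-admissible w)

-- The first letter can be read off: it is D if `γ` vanishes at `zero`, otherwise H if `ι` does,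
-- otherwise U.
path-injective : ∀ {x d h} (v w : Path x d h) →
  (∀ p → γ v p ≡ γ w p) → (∀ q → ι v q ≡ ι w q) → v ≡ w
path-injective ε     ε     _  _  = refl
path-injective (D v) (D w) γ≗ ι≗ = cong D_ (path-injective v w (γ≗ ∘ suc) ι≗)
path-injective (D v) (U w) γ≗ ι≗ with () ← γ≗ zero
path-injective (D v) (H w) γ≗ ι≗ with () ← γ≗ zero
path-injective (U v) (D w) γ≗ ι≗ with () ← γ≗ zero
path-injective (U v) (U w) γ≗ ι≗ =
  cong U_ (path-injective v w (cong pred ∘ γ≗) (cong pred ∘ ι≗))
path-injective (U v) (H w) γ≗ ι≗ with () ← ι≗ zero
path-injective (H v) (D w) γ≗ ι≗ with () ← γ≗ zero
path-injective (H v) (U w) γ≗ ι≗ with () ← ι≗ zero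
path-injective (H v) (H w) γ≗ ι≗ =
  cong H_ (path-injective v w (cong pred ∘ γ≗) (ι≗ ∘ suc))

admissible-D : ∀ {x d h g i} → Admissible x (suc d) h g i → Admissible (suc x) d h (g ∘ suc) i
admissible-D {x} {d} {h} {g} {i} (admissible g-mono i-mono i≤ g≤) = admissible
  (λ p r → g-mono (suc p) (suc r) ∘ s≤s)
  i-mono
  (λ q → subst (i q ≤_) (+-suc x d) (i≤ q))
  (λ p → subst (λ t → g (suc p) ≤ t + count h (λ q → i q <ᵇ suc t)) (+-suc x (toℕ p)) (g≤ (suc p)))

admissible-H : ∀ {x d h g i} → Admissible x d (suc h) g i → i zero ≡ 0 →
               Admissible x d h (pred ∘ g) (i ∘ suc)
admissible-H {x} {d} {h} {g} {i} (admissible g-mono i-mono i≤ g≤) i₀≡0 = admissible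
  (λ p r → pred-mono-≤ ∘ g-mono p r)
  (λ q r → i-mono (suc q) (suc r) ∘ s≤s)
  (i≤ ∘ suc)
  (λ p → pred-mono-≤ (subst (g p ≤_) (shift (x + toℕ p)) (g≤ p)))
  where
  shift : ∀ t → t + count (suc h) (λ q → i q <ᵇ suc t) ≡
                suc (t + count h (λ q → i (suc q) <ᵇ suc t))
  shift t rewrite i₀≡0 = +-suc t _

admissible-U : ∀ {x d h g i} → Admissible (suc x) d h g i → (∀ q → 1 ≤ i q) →
               Admissible x d h (pred ∘ g) (pred ∘ i)
admissible-U {x} {d} {h} {g} {i} (admissible g-mono i-mono i≤ g≤) i-pos = admissible
  (λ p r → pred-mono-≤ ∘ g-mono p r)
  (λ q r → pred-mono-≤ ∘ i-mono q r)
  (pred-mono-≤ ∘ i≤)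
  (λ p → pred-mono-≤ (≤-trans (g≤ p)
    (≤-reflexive (cong (suc (x + toℕ p) +_) (count-cong h λ q → <ᵇ-pred (i-pos q))))))
  where
  <ᵇ-pred : ∀ {m t} → 1 ≤ m → (m <ᵇ suc (suc t)) ≡ (pred m <ᵇ suc t)
  <ᵇ-pred {suc m} _ = refl

first? : ∀ {n} (f : Fin (suc n) → ℕ) → (∀ p r → toℕ p ≤ toℕ r → f p ≤ f r) →
         f zero ≡ 0 ⊎ (∀ p → 1 ≤ f p)
first? f mono with f zero in e
... | zero  = inj₁ refl
... | suc _ = inj₂ λ p → ≤-trans (subst (1 ≤_) (sym e) (s≤s z≤n)) (mono zero p z≤n)

suc-pred≡ : ∀ {m} → 1 ≤ m → suc (pred m) ≡ m
suc-pred≡ {suc m} _ = refl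

Decoding : ∀ x d h → (Fin d → ℕ) → (Fin h → ℕ) → Set
Decoding x d h g i = ∃ λ (w : Path x d h) → (∀ p → γ w p ≡ g p) × (∀ q → ι w q ≡ i q)

-- Greedy decoding with the tests in the order D, H, U; `decodeᴴ` and `decodeᵁ` record that the
-- earlier tests failed. Each letter lowers (d, h, x) lexicographically.
decode  : ∀ x d h {g i} → Admissible x d h g i → Decoding x d h g i
decodeᴴ : ∀ x d h {g i} → Admissible x d h g i → (∀ p → 1 ≤ g p) → Decoding x d h g i
decodeᵁ : ∀ x d h {g i} → Admissible x d h g i → (∀ p → 1 ≤ g p) → (∀ q → 1 ≤ i q) →
          Decoding x d h g i

decode x zero    h     ad = decodeᴴ x zero h ad λ ()
decode x (suc d) h {g} ad =
  [ (λ g₀≡0 → let w , γ≡ , ι≡ = decode (suc x) d h (admissible-D ad) in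
       D w , (λ { zero → sym g₀≡0 ; (suc p) → γ≡ p }) , ι≡)
  , decodeᴴ x (suc d) h ad
  ]′ (first? g (Admissible.g-mono ad))

decodeᴴ x d zero            ad g-pos = decodeᵁ x d zero ad g-pos λ ()
decodeᴴ x d (suc h) {i = i} ad g-pos =
  [ (λ i₀≡0 → let w , γ≡ , ι≡ = decode x d h (admissible-H ad i₀≡0) in
       H w , (λ p → trans (cong suc (γ≡ p)) (suc-pred≡ (g-pos p)))
           , (λ { zero → sym i₀≡0 ; (suc q) → ι≡ q }))
  , decodeᵁ x d (suc h) ad g-pos
  ]′ (first? i (Admissible.i-mono ad))

decodeᵁ (suc x) d h ad g-pos i-pos =
  let w , γ≡ , ι≡ = decode x d h (admissible-U ad i-pos) in
  U w , (λ p → trans (cong suc (γ≡ p)) (suc-pred≡ (g-pos p)))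
      , (λ q → trans (cong suc (ι≡ q)) (suc-pred≡ (i-pos q)))
-- With x = 0 no U may come next, so only the empty word survives: a remaining H would have i ≤ 0,
-- and a remaining D would have g ≤ 0 because no i vanishes.
decodeᵁ zero zero    zero    ad _     _     = ε , (λ ()) , (λ ())
decodeᵁ zero zero    (suc h) ad _     i-pos =
  contradiction (≤-trans (i-pos zero) (Admissible.i≤ ad zero)) λ ()
decodeᵁ zero (suc d) h       ad g-pos i-pos = contradiction
  (≤-trans (g-pos zero) (≤-trans (Admissible.g≤ ad zero) (count-≤ h 0 λ q lt →
    contradiction (<ᵇ-true⁻¹ lt) (≤⇒≯ (i-pos q)))))
  λ ()

-- Paths and increasing parking functions

module _ {k n : ℕ} {f : Fin (k + n) → ℕ} {g : Fin k → ℕ} {i : Fin n → ℕ}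
         (f-clique : ∀ p → f (p ↑ˡ n) ≡ suc (g p)) (f-indep : ∀ q → f (k ↑ʳ q) ≡ suc (i q)) where

  count-shift : ∀ t → count n (λ q → f (k ↑ʳ q) <ᵇ suc t) ≡ count n (λ q → i q <ᵇ t)
  count-shift t = count-cong n λ q → cong (_<ᵇ suc t) (f-indep q)

  admissible⇒bounded : Admissible 0 k n g i → Bounded k n f
  admissible⇒bounded (admissible _ _ i≤ g≤) = bounded
    (↑-elim k n (λ u → 1 ≤ f u)
      (λ p → subst (1 ≤_) (sym (f-clique p)) (s≤s z≤n))
      (λ q → subst (1 ≤_) (sym (f-indep q)) (s≤s z≤n)))
    (λ q → subst (_≤ suc k) (sym (f-indep q)) (s≤s (i≤ q)))
    (λ p → subst₂ (λ a b → a ≤ suc (toℕ p) + b) (sym (f-clique p)) (sym (count-shift _)) (s≤s (g≤ p)))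

  admissible⇒increasing : Admissible 0 k n g i → IsIncreasing k n f
  admissible⇒increasing (admissible g-mono i-mono _ _) =
    ↑-elim k n (λ u → ∀ w → toℕ u ≤ toℕ w → toℕ w < k ⊎ k ≤ toℕ u → f u ≤ f w)
      (λ p → ↑-elim k n _
        (λ r p≤r _ → subst₂ _≤_ (sym (f-clique p)) (sym (f-clique r))
          (s≤s (g-mono p r (subst₂ _≤_ (toℕ-↑ˡ p n) (toℕ-↑ˡ r n) p≤r))))
        (λ { q _ (inj₁ q<k) → contradiction (subst (_< k) (toℕ-↑ʳ k q) q<k) (m+n≮m k _)
           ; q _ (inj₂ k≤p) → contradiction (subst (k ≤_) (toℕ-↑ˡ p n) k≤p) (<⇒≱ (toℕ<n p)) }))
      (λ q → ↑-elim k n _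
        (λ p q≤p _ → contradiction
          (≤-trans (m≤m+n k _) (subst₂ _≤_ (toℕ-↑ʳ k q) (toℕ-↑ˡ p n) q≤p)) (<⇒≱ (toℕ<n p)))
        (λ r q≤r _ → subst₂ _≤_ (sym (f-indep q)) (sym (f-indep r))
          (s≤s (i-mono q r (+-cancelˡ-≤ k _ _ (subst₂ _≤_ (toℕ-↑ʳ k q) (toℕ-↑ʳ k r) q≤r))))))

  bounded⇒admissible : IsIncreasing k n f → Bounded k n f → Admissible 0 k n g i
  bounded⇒admissible inc (bounded _ indep clique) = admissible
    (λ p r p≤r → s≤s⁻¹ (subst₂ _≤_ (f-clique p) (f-clique r) (increasing-clique inc p≤r)))
    (λ q r q≤r → s≤s⁻¹ (subst₂ _≤_ (f-indep q) (f-indep r) (increasing-indep inc q≤r)))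
    (λ q → s≤s⁻¹ (subst (_≤ suc k) (f-indep q) (indep q)))
    (λ p → s≤s⁻¹ (subst₂ (λ a b → a ≤ suc (toℕ p) + b) (f-clique p) (count-shift _) (clique p)))

path⤖PFinc : ∀ k n → Bijection (setoid (Path 0 k n)) (PFinc k n)
path⤖PFinc k n = record
  { to        = λ w → toPF w , bounded⇒isPF (admissible⇒bounded (clique w) (indep w) (path-admissible w))
                             , admissible⇒increasing (clique w) (indep w) (path-admissible w)
  ; cong      = λ { refl u → refl }
  ; bijective = (λ {v} {w} eq → path-injective v w
                  (λ p → cong pred (trans (sym (clique v p)) (trans (eq (p ↑ˡ n)) (clique w p))))
                  (λ q → cong pred (trans (sym (indep v q)) (trans (eq (k ↑ʳ q)) (indep w q)))))
              , surjective
  }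
  where
  toPF : Path 0 k n → Fin (k + n) → ℕ
  toPF w = (suc ∘ γ w) ++ (suc ∘ ι w)
  clique : ∀ w p → toPF w (p ↑ˡ n) ≡ suc (γ w p)
  clique w = lookup-++ˡ (suc ∘ γ w) (suc ∘ ι w)
  indep : ∀ w q → toPF w (k ↑ʳ q) ≡ suc (ι w q)
  indep w = lookup-++ʳ (suc ∘ γ w) (suc ∘ ι w)
  surjective : ∀ (y : Σ (Fin (k + n) → ℕ) λ f → IsPF (Split k n) f × IsIncreasing k n f) →
    ∃ λ w → ∀ {z} → z ≡ w → ∀ u → toPF z u ≡ proj₁ y u
  surjective (f , pf , inc) =
    let bd = isPF⇒bounded inc pf
        pos = Bounded.positive bd
        -- The word is decoded from `pred ∘ f`; positivity recovers f.
        f≡ = λ u → sym (suc-pred≡ (pos u))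
        w , γ≡ , ι≡ = decode 0 k n
          (bounded⇒admissible (λ p → f≡ (p ↑ˡ n)) (λ q → f≡ (k ↑ʳ q)) inc bd)
    in w , λ { refl → ↑-elim k n _
      (λ p → trans (clique w p) (trans (cong suc (γ≡ p)) (sym (f≡ (p ↑ˡ n)))))
      (λ q → trans (indep w q) (trans (cong suc (ι≡ q)) (sym (f≡ (k ↑ʳ q))))) }

-- The first clique vertex has index `zero`, so deleting it is `f ∘ suc`. Injectivity rests on its
-- value being forced to 1; the inverse prepends that 1.
PPFinc⤖PFinc : ∀ k n → Bijection (PPFinc (suc k) n) (PFinc k n)
PPFinc⤖PFinc k n = record
  { to        = λ (f , ppf , inc) →
                  f ∘ suc , bounded⇒isPF (prime⇒tail-bounded inc ppf) , tail-increasing inc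
  ; cong      = λ eq → eq ∘ suc
  ; bijective = (λ { {_ , ppf , inc} {_ , ppf′ , inc′} eq → λ
                     { zero → trans (first≡1 inc ppf) (sym (first≡1 inc′ ppf′)) ; (suc u) → eq u } })
              , λ (f , pf , inc) →
                  let bd = isPF⇒bounded inc pf in
                  (1∷ f , tail-bounded⇒prime refl bd , 1∷-increasing (Bounded.positive bd) inc)
                  , λ eq → eq ∘ suc
  }
  where
  1∷ : (Fin (k + n) → ℕ) → Fin (suc k + n) → ℕ
  1∷ f zero    = 1
  1∷ f (suc u) = f u

  tail-increasing : ∀ {f} → IsIncreasing (suc k) n f → IsIncreasing k n (f ∘ suc)
  tail-increasing inc u w u≤w (inj₁ w<k) = inc (suc u) (suc w) (s≤s u≤w) (inj₁ (s≤s w<k))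
  tail-increasing inc u w u≤w (inj₂ k≤u) = inc (suc u) (suc w) (s≤s u≤w) (inj₂ (s≤s k≤u))

  1∷-increasing : ∀ {f} → (∀ u → 1 ≤ f u) → IsIncreasing k n f → IsIncreasing (suc k) n (1∷ f)
  1∷-increasing pos inc zero    zero    _   _          = ≤-refl
  1∷-increasing pos inc zero    (suc w) _   _          = pos w
  1∷-increasing pos inc (suc u) (suc w) u≤w (inj₁ w<k) = inc u w (s≤s⁻¹ u≤w) (inj₁ (s≤s⁻¹ w<k))
  1∷-increasing pos inc (suc u) (suc w) u≤w (inj₂ k≤u) = inc u w (s≤s⁻¹ u≤w) (inj₂ (s≤s⁻¹ k≤u))

  first≡1 : ∀ {f} → IsIncreasing (suc k) n f → IsPPF (Split (suc k) n) f → f zero ≡ 1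
  first≡1 inc ppf = let bd = isPF⇒bounded inc (proj₁ ppf) in
    ≤-antisym (prime⇒first≤1 inc ppf bd) (Bounded.positive bd zero)

-- Counting paths

-- The summands, one for the empty word and one for each first letter, are named separately because
-- each gets its own weight identity below.
#ε #D #U #H #path : ℕ → ℕ → ℕ → ℕ
#path x d h = #ε x d h + (#D x d h + (#U x d h + #H x d h))
#ε 0 0 0 = 1
#ε _ _ _ = 0
#D x 0       h = 0
#D x (suc d) h = #path (suc x) d h
#U 0       d h = 0
#U (suc x) d h = #path x d h
#H x d 0       = 0
#H x d (suc h) = #path x d h

Pathᴱ Pathᴰ Pathᵁ Pathᴴ : ℕ → ℕ → ℕ → Set
Pathᴱ 0 0 0 = ⊤
Pathᴱ _ _ _ = ⊥
Pathᴰ x 0       h = ⊥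
Pathᴰ x (suc d) h = Path (suc x) d h
Pathᵁ 0       d h = ⊥
Pathᵁ (suc x) d h = Path x d h
Pathᴴ x d 0       = ⊥
Pathᴴ x d (suc h) = Path x d h

path-uncons : ∀ x d h → Path x d h ↔ (Pathᴱ x d h ⊎ (Pathᴰ x d h ⊎ (Pathᵁ x d h ⊎ Pathᴴ x d h)))
path-uncons x d h = mk↔ₛ′ uncons (cons x d h) (uncons-cons x d h) cons-uncons
  where
  Sum : ℕ → ℕ → ℕ → Set
  Sum x d h = Pathᴱ x d h ⊎ (Pathᴰ x d h ⊎ (Pathᵁ x d h ⊎ Pathᴴ x d h))
  uncons : ∀ {x d h} → Path x d h → Sum x d h
  uncons ε     = inj₁ tt
  uncons (D w) = inj₂ (inj₁ w)
  uncons (U w) = inj₂ (inj₂ (inj₁ w))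
  uncons (H w) = inj₂ (inj₂ (inj₂ w))
  consᴱ : ∀ x d h → Pathᴱ x d h → Path x d h
  consᴱ 0 0 0 tt = ε
  consᴰ : ∀ x d h → Pathᴰ x d h → Path x d h
  consᴰ x (suc d) h w = D w
  consᵁ : ∀ x d h → Pathᵁ x d h → Path x d h
  consᵁ (suc x) d h w = U w
  consᴴ : ∀ x d h → Pathᴴ x d h → Path x d h
  consᴴ x d (suc h) w = H w
  cons : ∀ x d h → Sum x d h → Path x d h
  cons x d h = [ consᴱ x d h , [ consᴰ x d h , [ consᵁ x d h , consᴴ x d h ]′ ]′ ]′
  uncons-consᴱ : ∀ x d h e → uncons (consᴱ x d h e) ≡ inj₁ e
  uncons-consᴱ 0 0 0 tt = refl
  uncons-consᴰ : ∀ x d h w → uncons (consᴰ x d h w) ≡ inj₂ (inj₁ w)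
  uncons-consᴰ x (suc d) h w = refl
  uncons-consᵁ : ∀ x d h w → uncons (consᵁ x d h w) ≡ inj₂ (inj₂ (inj₁ w))
  uncons-consᵁ (suc x) d h w = refl
  uncons-consᴴ : ∀ x d h w → uncons (consᴴ x d h w) ≡ inj₂ (inj₂ (inj₂ w))
  uncons-consᴴ x d (suc h) w = refl
  uncons-cons : ∀ x d h s → uncons (cons x d h s) ≡ s
  uncons-cons x d h (inj₁ e)               = uncons-consᴱ x d h e
  uncons-cons x d h (inj₂ (inj₁ w))        = uncons-consᴰ x d h w
  uncons-cons x d h (inj₂ (inj₂ (inj₁ w))) = uncons-consᵁ x d h w
  uncons-cons x d h (inj₂ (inj₂ (inj₂ w))) = uncons-consᴴ x d h w
  cons-uncons : ∀ {x d h} (w : Path x d h) → cons x d h (uncons w) ≡ w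
  cons-uncons ε     = refl
  cons-uncons (D w) = refl
  cons-uncons (U w) = refl
  cons-uncons (H w) = refl

path↔Fin : ∀ x d h → Path x d h ↔ Fin (#path x d h)
ε↔Fin    : ∀ x d h → Pathᴱ x d h ↔ Fin (#ε x d h)
D↔Fin    : ∀ x d h → Pathᴰ x d h ↔ Fin (#D x d h)
U↔Fin    : ∀ x d h → Pathᵁ x d h ↔ Fin (#U x d h)
H↔Fin    : ∀ x d h → Pathᴴ x d h ↔ Fin (#H x d h)

path↔Fin x d h = ↔-trans (path-uncons x d h)
  (⊎↔Fin (ε↔Fin x d h) (⊎↔Fin (D↔Fin x d h) (⊎↔Fin (U↔Fin x d h) (H↔Fin x d h))))
  where
  ⊎↔Fin : ∀ {A B : Set} {m n} → A ↔ Fin m → B ↔ Fin n → (A ⊎ B) ↔ Fin (m + n)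
  ⊎↔Fin A↔ B↔ = ↔-trans (A↔ ⊎-↔ B↔) (↔-sym +↔⊎)
ε↔Fin 0 0 0             = ↔-sym 1↔⊤
ε↔Fin 0 0 (suc h)       = ↔-sym 0↔⊥
ε↔Fin 0 (suc d) h       = ↔-sym 0↔⊥
ε↔Fin (suc x) d h       = ↔-sym 0↔⊥
D↔Fin x 0       h = ↔-sym 0↔⊥
D↔Fin x (suc d) h = path↔Fin (suc x) d h
U↔Fin 0       d h = ↔-sym 0↔⊥
U↔Fin (suc x) d h = path↔Fin x d h
H↔Fin x d 0       = ↔-sym 0↔⊥
H↔Fin x d (suc h) = path↔Fin x d h

-- The closed formula for the number of words

-- The denominator of #path = (x+1)(x+2d+h)! / ((x+d+1)! d! h!), a ballot number times the choice of
-- positions for the letters H. Multiplying it out avoids division in the induction.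
weight : ℕ → ℕ → ℕ → ℕ
weight x d h = suc (x + d) ! * (d ! * h !)

-- Induction on the first letter: (x+2)d + x(x+d+1) + (x+1)h = (x+1)(x+2d+h).
#path-weight : ∀ x d h → #path x d h * weight x d h ≡ suc x * (x + (d + d) + h) !
#D-weight : ∀ x d h → #D x d h * weight x d h ≡ d * suc (suc x) * pred (x + (d + d) + h) !
#U-weight : ∀ x d h → #U x d h * weight x d h ≡ x * suc (x + d) * pred (x + (d + d) + h) !
#H-weight : ∀ x d h → #H x d h * weight x d h ≡ h * suc x * pred (x + (d + d) + h) !

#path-weight x d h = begin
  #path x d h * w
    ≡⟨ distrib (#ε x d h) (#D x d h) (#U x d h) (#H x d h) w ⟩
  #ε x d h * w + (#D x d h * w + (#U x d h * w + #H x d h * w))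
    ≡⟨ cong (#ε x d h * w +_)
         (cong₂ _+_ (#D-weight x d h) (cong₂ _+_ (#U-weight x d h) (#H-weight x d h))) ⟩
  #ε x d h * w + (d * suc (suc x) * l + (x * suc (x + d) * l + h * suc x * l))
    ≡⟨ cong (#ε x d h * w +_) (collect x d h l) ⟩
  #ε x d h * w + suc x * ((x + (d + d) + h) * l)
    ≡⟨ total x d h ⟩
  suc x * (x + (d + d) + h) ! ∎
  where
  open ≡-Reasoning
  w l : ℕ
  w = weight x d h
  l = pred (x + (d + d) + h) !
  distrib : ∀ a b c e w → (a + (b + (c + e))) * w ≡ a * w + (b * w + (c * w + e * w))
  distrib = solve-∀
  collect : ∀ x d h l → d * suc (suc x) * l + (x * suc (x + d) * l + h * suc x * l)
            ≡ suc x * ((x + (d + d) + h) * l)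
  collect = solve-∀
  -- For positive length L this is L * (L-1)! = L!. At length 0 that product vanishes and the empty
  -- word supplies 0! = 1.
  total : ∀ x d h → #ε x d h * weight x d h
            + suc x * ((x + (d + d) + h) * pred (x + (d + d) + h) !) ≡ suc x * (x + (d + d) + h) !
  total 0 0 0       = refl
  total 0 0 (suc h) = refl
  total 0 (suc d) h = refl
  total (suc x) d h = refl

#D-weight x zero    h = refl
-- Deleting D leaves x + d unchanged in total, so the weights differ by the factor `suc d` only; U
-- and H similarly cost `suc (suc x + d)` and `suc h`.
#D-weight x (suc d) h = begin
  #path (suc x) d h * (suc (x + suc d) ! * ((suc d) ! * h !))
    ≡⟨ cong (λ t → #path (suc x) d h * (suc t ! * ((suc d) ! * h !))) (+-suc x d) ⟩
  #path (suc x) d h * (suc (suc x + d) ! * ((suc d) ! * h !))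
    ≡⟨ pull (#path (suc x) d h) (suc (suc x + d) !) (suc d) (d !) (h !) ⟩
  suc d * (#path (suc x) d h * weight (suc x) d h)
    ≡⟨ cong (suc d *_) (#path-weight (suc x) d h) ⟩
  suc d * (suc (suc x) * (suc x + (d + d) + h) !)
    ≡⟨ *-assoc (suc d) (suc (suc x)) ((suc x + (d + d) + h) !) ⟨
  suc d * suc (suc x) * (suc x + (d + d) + h) !
    ≡⟨ cong (λ t → suc d * suc (suc x) * pred t !) (length x d h) ⟩
  suc d * suc (suc x) * pred (x + (suc d + suc d) + h) ! ∎
  where
  open ≡-Reasoning
  pull : ∀ N a s b c → N * (a * (s * b * c)) ≡ s * (N * (a * (b * c)))
  pull = solve-∀
  length : ∀ x d h → suc (suc x + (d + d) + h) ≡ x + (suc d + suc d) + h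
  length = solve-∀

#U-weight zero    d h = refl
#U-weight (suc x) d h = begin
  #path x d h * (suc (suc x + d) * suc (x + d) ! * (d ! * h !))
    ≡⟨ pull (#path x d h) (suc (suc x + d)) (suc (x + d) !) (d ! * h !) ⟩
  suc (suc x + d) * (#path x d h * weight x d h)
    ≡⟨ cong (suc (suc x + d) *_) (#path-weight x d h) ⟩
  suc (suc x + d) * (suc x * (x + (d + d) + h) !)
    ≡⟨ swap (suc (suc x + d)) (suc x) ((x + (d + d) + h) !) ⟩
  suc x * suc (suc x + d) * (x + (d + d) + h) ! ∎
  where
  open ≡-Reasoning
  pull : ∀ N s a b → N * (s * a * b) ≡ s * (N * (a * b))
  pull = solve-∀
  swap : ∀ a b c → a * (b * c) ≡ b * a * c
  swap = solve-∀

#H-weight x d zero    = refl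
#H-weight x d (suc h) = begin
  #path x d h * (suc (x + d) ! * (d ! * (suc h) !))
    ≡⟨ pull (#path x d h) (suc (x + d) !) (d !) (suc h) (h !) ⟩
  suc h * (#path x d h * weight x d h)
    ≡⟨ cong (suc h *_) (#path-weight x d h) ⟩
  suc h * (suc x * (x + (d + d) + h) !)
    ≡⟨ *-assoc (suc h) (suc x) _ ⟨
  suc h * suc x * (x + (d + d) + h) !
    ≡⟨ cong (λ t → suc h * suc x * pred t !) (+-suc (x + (d + d)) h) ⟨
  suc h * suc x * pred (x + (d + d) + suc h) ! ∎
  where
  open ≡-Reasoning
  pull : ∀ N a b s c → N * (a * (b * (s * c))) ≡ s * (N * (a * (b * c)))
  pull = solve-∀

[m+n]Cn*n!*m!≡[m+n]! : ∀ m n → ((m + n) C n) * (n ! * m !) ≡ (m + n) !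
[m+n]Cn*n!*m!≡[m+n]! m n = begin
  ((m + n) C n) * (n ! * m !)
    ≡⟨ cong (λ t → ((m + n) C n) * (n ! * t !)) (m+n∸n≡m m n) ⟨
  ((m + n) C n) * (n ! * (m + n ∸ n) !)
    ≡⟨ cong (_* (n ! * (m + n ∸ n) !)) (nCk≡n!/k![n-k]! (m≤n+m n m)) ⟩
  (m + n) ! / (n ! * (m + n ∸ n) !) * (n ! * (m + n ∸ n) !)
    ≡⟨ m/n*n≡m (k![n∸k]!∣n! (m≤n+m n m)) ⟩
  (m + n) ! ∎
  where
  open ≡-Reasoning
  instance _ = n !* (m + n ∸ n) !≢0

-- At x = 0 both sides, cleared of the divisor k + 1 and multiplied by k! k! n!, equal (2k+n)!. The
-- division is therefore exact.
#path≡ : ∀ k n → #path 0 k n ≡ (((2 * k) C k) * ((2 * k + n) C n)) / suc k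
#path≡ k n = trans (sym (m*n/n≡m (#path 0 k n) (suc k))) (cong (_/ suc k) (sym product≡))
  where
  open ≡-Reasoning
  instance
    _ = k !* k !≢0
    _ = n !≢0
    _ = m*n≢0 (k ! * k !) (n !)
  rearrange : ∀ P Q a c → P * Q * (a * a * c) ≡ Q * (c * (P * (a * a)))
  rearrange = solve-∀
  rearrange′ : ∀ N s a c → 1 * (N * (s * a * (a * c))) ≡ N * s * (a * a * c)
  rearrange′ = solve-∀
  2k≡ : 2 * k ≡ k + k
  2k≡ = cong (k +_) (+-identityʳ k)
  product≡ : ((2 * k) C k) * ((2 * k + n) C n) ≡ #path 0 k n * suc k
  product≡ rewrite 2k≡ = *-cancelʳ-≡ _ _ (k ! * k ! * n !) (begin
    P * Q * (k ! * k ! * n !)              ≡⟨ rearrange P Q (k !) (n !) ⟩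
    Q * (n ! * (P * (k ! * k !)))          ≡⟨ cong (λ t → Q * (n ! * t)) ([m+n]Cn*n!*m!≡[m+n]! k k) ⟩
    Q * (n ! * (k + k) !)                  ≡⟨ [m+n]Cn*n!*m!≡[m+n]! (k + k) n ⟩
    (k + k + n) !                          ≡⟨ *-identityˡ _ ⟨
    1 * (k + k + n) !                      ≡⟨ #path-weight 0 k n ⟨
    #path 0 k n * weight 0 k n             ≡⟨ *-identityˡ _ ⟨
    1 * (#path 0 k n * weight 0 k n)       ≡⟨ rearrange′ (#path 0 k n) (suc k) (k !) (n !) ⟩
    #path 0 k n * suc k * (k ! * k ! * n !) ∎)
    where
    P Q : ℕ
    P = (k + k) C k
    Q = (k + k + n) C n

PFinc⤖Fin : ∀ k n → Bijection (PFinc k n) (setoid (Fin ((((2 * k) C k) * ((2 * k + n) C n)) / suc k)))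
PFinc⤖Fin k n = ⤖-trans
  (Inverse⇒Bijection (Symmetry.inverse (Bijection⇒Inverse (path⤖PFinc k n))))
  (subst (λ N → Bijection (setoid (Path 0 k n)) (setoid (Fin N))) (#path≡ k n) (↔⇒⤖ (path↔Fin 0 k n)))

-- Here `k` is m - 1, and cardinalities are expressed by bijections with `Fin`.
theorem3p13 : ∀ (k n : ℕ) → 1 ≤ n →
    Bijection (PPFinc (suc k) n) (PFinc k n) ×
    Bijection (PPFinc (suc k) n) (setoid (Fin ((((2 * k) C k) * ((2 * k + n) C n)) / suc k))) ×
    Bijection (PFinc k n) (setoid (Fin ((((2 * k) C k) * ((2 * k + n) C n)) / suc k)))
theorem3p13 k n _ =
  PPFinc⤖PFinc k n , ⤖-trans (PPFinc⤖PFinc k n) (PFinc⤖Fin k n) , PFinc⤖Fin k n
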